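{- Let $F$ be a connected graph with constant link $L$, order $k$ and circumference $c$, where $3 \leq c \leq k$. Then, for all integers $t \geq 2$ and $g > c$, there exists a connected graph $G_{t,F,g}$ with constant link $tL$ which contains no cycle of length $\ell$ for any $c < \ell < g$.
   Context: All graphs are finite and simple. A graph $G$ has constant link $L$ if for every vertex $v$ of $G$ the subgraph $G[N(v)]$ induced by the open neighborhood of $v$ is isomorphic to $L$. $tL$ denotes the disjoint union of $t$ copies of $L$. The circumference of a graph is the length of a longest cycle in it. The order of a graph is its number of vertices. -}

module Defs where

open import Data.Bool.Base using (Bool; T; _∧_)
open import Data.Bool.Properties using (T-∧)
open import Data.Fin.Base using (Fin; toℕ)
open import Data.Fin.Properties using (_≟_)
open import Data.Nat.Base using (ℕ; suc; _≤_)
open import Data.Product.Base using (Σ; ∃; _×_; _,_; proj₁; proj₂)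
open import Function.Base using (_on_)
open import Function.Bundles using (_↔_; Inverse; Equivalence)
open import Function.Definitions using (Injective)
open import Relation.Binary.Construct.Closure.ReflexiveTransitive using (Star)
open import Relation.Binary.Definitions using (Symmetric)
open import Relation.Binary.PropositionalEquality.Core using (_≡_; sym)
open import Relation.Nullary.Decidable using (⌊_⌋; toWitness; fromWitness)
open import Relation.Nullary.Negation.Core using (¬_)

-- Simple graphs. Adjacency is Boolean-valued, so it is decidable and
-- T (adj u v) has at most one proof; hence Σ Vertex (T ∘ p) is a genuine
-- subset of Vertex. Finiteness is the separate predicate Finite.

record Graph : Set₁ where
  field
    Vertex : Set
    adj    : Vertex → Vertex → Bool

  _~_ : Vertex → Vertex → Set
  u ~ v = T (adj u v)

  field
    ~-sym    : Symmetric _~_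
    ~-irrefl : ∀ v → ¬ (v ~ v)

open Graph public using (Vertex)

HasOrder : Graph → ℕ → Set
HasOrder G n = Vertex G ↔ Fin n

Finite : Graph → Set
Finite G = ∃ (HasOrder G)

infix 4 _≅_

record _≅_ (G H : Graph) : Set where
  private
    module G = Graph G
    module H = Graph H
  field
    bijection : G.Vertex ↔ H.Vertex
  open Inverse bijection using (to)
  field
    adj-preserved : ∀ u v → G.adj u v ≡ H.adj (to u) (to v)

induced : (G : Graph) → (Vertex G → Bool) → Graph
induced G p = record
  { Vertex   = Σ G.Vertex (λ v → T (p v))
  ; adj      = G.adj on proj₁
  ; ~-sym    = G.~-sym
  ; ~-irrefl = λ v → G.~-irrefl (proj₁ v)
  }
  where module G = Graph G

link : (G : Graph) → Vertex G → Graph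
link G v = induced G (Graph.adj G v)

HasConstantLink : Graph → Graph → Set
HasConstantLink G L = ∀ v → link G v ≅ L

copies : ℕ → Graph → Graph
copies t L = record
  { Vertex   = Fin t × L.Vertex
  ; adj      = λ (i , u) (j , v) → ⌊ i ≟ j ⌋ ∧ L.adj u v
  ; ~-sym    = λ e → let (i≡j , u~v) = Equivalence.to T-∧ e in
      Equivalence.from T-∧ (fromWitness (sym (toWitness i≡j)) , L.~-sym u~v)
  ; ~-irrefl = λ (i , v) e → L.~-irrefl v (proj₂ (Equivalence.to (T-∧ {⌊ i ≟ i ⌋}) e))
  }
  where module L = Graph L

-- The graph with no vertices is not counted as connected.
Connected : Graph → Set
Connected G = G.Vertex × (∀ u v → Star G._~_ u v)
  where module G = Graph G

record Cycle (G : Graph) (ℓ : ℕ) : Set where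
  open Graph G using (_~_)
  field
    length≥3  : 3 ≤ ℓ
    vertex    : Fin ℓ → Vertex G
    injective : Injective _≡_ _≡_ vertex
    step      : ∀ i j → suc (toℕ i) ≡ toℕ j → vertex i ~ vertex j
    closing   : ∀ i j → suc (toℕ i) ≡ ℓ → toℕ j ≡ 0 → vertex i ~ vertex j

HasCircumference : Graph → ℕ → Set
HasCircumference G c = Cycle G c × (∀ ℓ → Cycle G ℓ → ℓ ≤ c)

{-# OPTIONS --safe #-}
module Submission where

-- Let S = Fin t × V(F) act by involutions on a finite set Y. Glue t families of copies
-- of F on V(F) × Y, the i-th joining (a , y) to (b , z) when a ~ b in F and
-- (i , a) y = (i , b) z. A cycle either stays in one copy of F, and then has length at
-- most c, or it crosses n copies, 2 ≤ n ≤ ℓ, and spells a reduced word of length 2n in S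
-- that fixes a state. Following Biggs, S acts on the ball of radius 2g in the tree of
-- words so that reduced words of length at most 2g move the root; on enumerations of
-- this ball such words then act without fixed points. G is a connected component.

open import Defs
open import Data.Bool.Base using (Bool; true; false; T; _∧_; if_then_else_)
open import Data.Bool.Properties using (T-∧; T-irrelevant)
open import Data.Empty using (⊥-elim)
open import Data.Fin.Base using (Fin; zero; suc; toℕ)
open import Data.Fin.Properties using (any?; toℕ-fromℕ<; toℕ-injective; toℕ<n; 0↔⊥; 1↔⊤; +↔⊎; *↔×)
  renaming (_≟_ to _≟ᶠ_)
open import Data.List.Base using (List; []; _∷_; tabulate)
open import Data.List.Membership.Propositional using (_∈_)
open import Data.List.Membership.Propositional.Properties using (∈-tabulate⁺)
open import Data.List.Relation.Unary.Any using (here; there)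
open import Data.Nat.Base using (ℕ; zero; suc; _+_; _*_; _≤_; _<_; z≤n; s≤s; z<s; NonZero; >-nonZero)
open import Data.Nat.DivMod using (_%_; _mod_; m%n<n; m<n⇒m%n≡m; n%n≡0)
open import Data.Nat.Properties
  using (≤-refl; <-trans; ≤-<-trans; <-≤-trans; <⇒≤; <⇒≢; <⇒≱; n<1+n;
    m<1+n⇒m≤n; m≤n⇒m≤1+n; m≤n⇒m<n∨m≡n; *-monoˡ-≤)
open import Data.Product.Base using (Σ; Σ-syntax; ∃; ∃₂; _×_; _,_; proj₁; proj₂)
open import Data.Product.Function.NonDependent.Propositional using (_×-↔_)
open import Data.Sum.Base using (_⊎_; inj₁; inj₂)
open import Data.Sum.Function.Propositional using (_⊎-↔_)
open import Data.Unit.Base using (⊤; tt)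
open import Data.Vec.Base as Vec using (Vec; []; _∷_; lookup)
open import Data.Vec.Properties using (lookup-map; lookup∘tabulate; map-∘; map-id; map-cong)
open import Function.Base using (_∘_; id)
open import Function.Bundles using (_↔_; Inverse; Equivalence; mk↔ₛ′)
open import Function.Construct.Composition using (_↔-∘_)
open import Function.Construct.Identity using (↔-id)
open import Function.Construct.Symmetry using (↔-sym)
open import Function.Properties.Inverse using (↔⇒↣)
open import Relation.Binary.Construct.Closure.ReflexiveTransitive using (Star; ε; _◅_; _◅◅_; reverse)
open import Relation.Binary.Definitions using (DecidableEquality)
open import Relation.Binary.PropositionalEquality
  using (_≡_; _≢_; refl; sym; trans; cong; cong₂; subst; ≢-sym; module ≡-Reasoning)
open import Relation.Nullary.Decidable
  using (Dec; yes; no; ⌊_⌋; toWitness; fromWitness; via-injection; _×-dec_; _⊎-dec_; T?)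
open import Relation.Nullary.Negation.Core using (¬_; contradiction)

-- Boolean subsets and finite sets

T-ext : ∀ {a b} → (T a → T b) → (T b → T a) → a ≡ b
T-ext {false} {false} f g = refl
T-ext {false} {true}  f g = ⊥-elim (g tt)
T-ext {true}  {false} f g = ⊥-elim (f tt)
T-ext {true}  {true}  f g = refl

Σ-T-≡ : {A : Set} {p : A → Bool} {x y : Σ A (T ∘ p)} → proj₁ x ≡ proj₁ y → x ≡ y
Σ-T-≡ {x = a , _} refl = cong (a ,_) (T-irrelevant _ _)

FiniteSet : Set → Set
FiniteSet A = ∃ λ n → A ↔ Fin n

finite-≟ : {A : Set} → FiniteSet A → DecidableEquality A
finite-≟ (_ , A↔n) = via-injection (↔⇒↣ A↔n) _≟ᶠ_

finite-↔ : {A B : Set} → A ↔ B → FiniteSet B → FiniteSet A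
finite-↔ A↔B (n , B↔n) = n , B↔n ↔-∘ A↔B

finite-⊤ : FiniteSet ⊤
finite-⊤ = 1 , ↔-sym 1↔⊤

finite-⊎ : {A B : Set} → FiniteSet A → FiniteSet B → FiniteSet (A ⊎ B)
finite-⊎ (m , A↔m) (n , B↔n) = m + n , ↔-sym +↔⊎ ↔-∘ (A↔m ⊎-↔ B↔n)

finite-× : {A B : Set} → FiniteSet A → FiniteSet B → FiniteSet (A × B)
finite-× (m , A↔m) (n , B↔n) = m * n , ↔-sym *↔× ↔-∘ (A↔m ×-↔ B↔n)

finite-Vec : {A : Set} → FiniteSet A → ∀ n → FiniteSet (Vec A n)
finite-Vec finA zero = finite-↔ (mk↔ₛ′ (λ _ → tt) (λ _ → []) (λ _ → refl) (λ { [] → refl })) finite-⊤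
finite-Vec {A} finA (suc n) = finite-↔ uncons↔ (finite-× finA (finite-Vec finA n))
  where
  uncons↔ : Vec A (suc n) ↔ (A × Vec A n)
  uncons↔ = mk↔ₛ′ (λ { (x ∷ xs) → x , xs }) (λ { (x , xs) → x ∷ xs }) (λ _ → refl) (λ { (_ ∷ _) → refl })

finite-T : ∀ b → FiniteSet (T b)
finite-T false = 0 , ↔-sym 0↔⊥
finite-T true  = finite-⊤

finite-subset-Fin : ∀ n (p : Fin n → Bool) → FiniteSet (Σ (Fin n) (T ∘ p))
finite-subset-Fin zero p = 0 , mk↔ₛ′ proj₁ (λ ()) (λ ()) (λ { (() , _) })
finite-subset-Fin (suc n) p = finite-↔ split (finite-⊎ (finite-T (p zero)) (finite-subset-Fin n (p ∘ suc)))
  where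
  split : Σ (Fin (suc n)) (T ∘ p) ↔ (T (p zero) ⊎ Σ (Fin n) (T ∘ p ∘ suc))
  split = mk↔ₛ′
    (λ { (zero , e) → inj₁ e ; (suc i , e) → inj₂ (i , e) })
    (λ { (inj₁ e) → zero , e ; (inj₂ (i , e)) → suc i , e })
    (λ { (inj₁ _) → refl ; (inj₂ _) → refl })
    (λ { (zero , _) → refl ; (suc _ , _) → refl })

finite-subset : {A : Set} → FiniteSet A → (p : A → Bool) → FiniteSet (Σ A (T ∘ p))
finite-subset {A} (n , A↔n) p = finite-↔ transport (finite-subset-Fin n (p ∘ from))
  where
  open Inverse A↔n using (to; from; strictlyInverseˡ; strictlyInverseʳ)
  transport : Σ A (T ∘ p) ↔ Σ (Fin n) (T ∘ p ∘ from)
  transport = mk↔ₛ′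
    (λ (a , e) → to a , subst (T ∘ p) (sym (strictlyInverseʳ a)) e)
    (λ (i , e) → from i , e)
    (λ (i , _) → Σ-T-≡ (strictlyInverseˡ i))
    (λ (a , _) → Σ-T-≡ (strictlyInverseʳ a))

-- Connected components of finite graphs

module Component (K : Graph) (finite : Finite K) (o : Vertex K) where
  open Graph K using (adj; _~_; ~-sym)

  -- Walks all of whose inner vertices lie in the list, as in the Floyd–Warshall algorithm.
  Reach : List (Vertex K) → Vertex K → Vertex K → Set
  Reach []       u v = (u ≡ v) ⊎ (u ~ v)
  Reach (p ∷ ps) u v = Reach ps u v ⊎ (Reach ps u p × Reach ps p v)

  reach? : ∀ ps u v → Dec (Reach ps u v)
  reach? []       u v = finite-≟ finite u v ⊎-dec T? (adj u v)
  reach? (p ∷ ps) u v = reach? ps u v ⊎-dec (reach? ps u p ×-dec reach? ps p v)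

  reach-base : ∀ ps {u v} → Reach [] u v → Reach ps u v
  reach-base []       e = e
  reach-base (_ ∷ ps) e = inj₁ (reach-base ps e)

  -- Walks may be concatenated at a vertex that is allowed as an inner vertex. Transitivity at an
  -- unlisted `w` would fail, so the pivot list is walked down until `w` itself is the pivot.
  reach-trans : ∀ {ps u w v} → w ∈ ps → Reach ps u w → Reach ps w v → Reach ps u v
  reach-trans (here refl) r s = inj₂ (to-pivot r , from-pivot s)
    where
    to-pivot : ∀ {p ps u} → Reach (p ∷ ps) u p → Reach ps u p
    to-pivot (inj₁ r)       = r
    to-pivot (inj₂ (r , _)) = r
    from-pivot : ∀ {p ps v} → Reach (p ∷ ps) p v → Reach ps p v
    from-pivot (inj₁ r)       = r
    from-pivot (inj₂ (_ , r)) = r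
  reach-trans (there w∈) (inj₁ r)        (inj₁ s)        = inj₁ (reach-trans w∈ r s)
  reach-trans (there w∈) (inj₁ r)        (inj₂ (s , s′)) = inj₂ (reach-trans w∈ r s , s′)
  reach-trans (there w∈) (inj₂ (r , r′)) (inj₁ s)        = inj₂ (r , reach-trans w∈ r′ s)
  -- Both walks visit the pivot: the closed detour from the pivot through `w` and back is cut out.
  reach-trans (there w∈) (inj₂ (r , _))  (inj₂ (_ , s))  = inj₂ (r , s)

  reach⇒star : ∀ ps {u v} → Reach ps u v → Star _~_ u v
  reach⇒star []       (inj₁ refl)    = ε
  reach⇒star []       (inj₂ e)       = e ◅ ε
  reach⇒star (_ ∷ ps) (inj₁ r)       = reach⇒star ps r
  reach⇒star (_ ∷ ps) (inj₂ (r , s)) = reach⇒star ps r ◅◅ reach⇒star ps s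

  vertices : List (Vertex K)
  vertices = tabulate (Inverse.from (proj₂ finite))

  ∈-vertices : ∀ v → v ∈ vertices
  ∈-vertices v = subst (_∈ vertices) (Inverse.strictlyInverseʳ (proj₂ finite) v)
    (∈-tabulate⁺ (Inverse.to (proj₂ finite) v))

  star⇒reach : ∀ {u v} → Star _~_ u v → Reach vertices u v
  star⇒reach ε       = reach-base vertices (inj₁ refl)
  star⇒reach (e ◅ s) = reach-trans (∈-vertices _) (reach-base vertices (inj₂ e)) (star⇒reach s)

  inComponent : Vertex K → Bool
  inComponent v = ⌊ reach? vertices o v ⌋

  star⇒inComponent : ∀ {v} → Star _~_ o v → T (inComponent v)
  star⇒inComponent {v} s = fromWitness {a? = reach? vertices o v} (star⇒reach s)

  inComponent⇒star : ∀ v → T (inComponent v) → Star _~_ o v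
  inComponent⇒star v r = reach⇒star vertices (toWitness {a? = reach? vertices o v} r)

  closed : ∀ {u v} → T (inComponent u) → u ~ v → T (inComponent v)
  closed {u} r e = star⇒inComponent (inComponent⇒star u r ◅◅ (e ◅ ε))

  component : Graph
  component = induced K inComponent

  component-finite : Finite component
  component-finite = finite-subset finite inComponent

  star-component : ∀ {u v} (s : Star _~_ u v) (r : T (inComponent u)) (r′ : T (inComponent v)) →
    Star (Graph._~_ component) (u , r) (v , r′)
  star-component ε r r′ = subst (λ q → Star (Graph._~_ component) (_ , r) (_ , q)) (T-irrelevant r r′) ε
  star-component (e ◅ s) r r′ = e ◅ star-component s (closed r e) r′

  component-connected : Connected component
  component-connected = (o , r₀) , λ u v → reverse (λ {x} {y} → Graph.~-sym component {x} {y}) (path u) ◅◅ path v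
    where
    r₀ : T (inComponent o)
    r₀ = star⇒inComponent ε
    path : ∀ u → Star (Graph._~_ component) (o , r₀) u
    path (u , r) = star-component (inComponent⇒star u r) r₀ r

-- Involutions on words of bounded length

module Words {S : Set} (_≟_ : DecidableEquality S) where

  data Word : ℕ → Set where
    []  : ∀ {n} → Word n
    _∷_ : ∀ {n} → S → Word n → Word (suc n)

  finite-Word : FiniteSet S → ∀ n → FiniteSet (Word n)
  finite-Word finS zero    = finite-↔ (mk↔ₛ′ (λ _ → tt) (λ _ → []) (λ _ → refl) (λ { [] → refl })) finite-⊤
  finite-Word finS (suc n) = finite-↔ uncons↔ (finite-⊎ finite-⊤ (finite-× finS (finite-Word finS n)))
    where
    uncons↔ : Word (suc n) ↔ (⊤ ⊎ (S × Word n))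
    uncons↔ = mk↔ₛ′
      (λ { [] → inj₁ tt ; (c ∷ w) → inj₂ (c , w) })
      (λ { (inj₁ tt) → [] ; (inj₂ (c , w)) → c ∷ w })
      (λ { (inj₁ tt) → refl ; (inj₂ _) → refl })
      (λ { [] → refl ; (_ ∷ _) → refl })

  -- Words are the nodes of a tree with edges coloured by last letters. The edges of
  -- colour s contain a matching, chosen greedily from the root; toggle s swaps its pairs.
  toggle : ∀ {n} → S → Word n → Word n
  -- On the boundary of the ball there is no child left, so a node not matched to its parent stays
  -- fixed.
  toggle {zero}  s [] = []
  toggle {suc n} s [] = s ∷ []
  toggle s (c ∷ [])    = if ⌊ c ≟ s ⌋ then [] else c ∷ toggle s []
  toggle s (c ∷ d ∷ w) = if ⌊ c ≟ s ⌋ then c ∷ d ∷ toggle s w else c ∷ toggle s (d ∷ w)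

  toggle-≢ : ∀ {n s c} (w : Word n) → c ≢ s → toggle s (c ∷ w) ≡ c ∷ toggle s w
  toggle-≢ {s = s} {c} [] c≢s with c ≟ s
  ... | yes c≡s = contradiction c≡s c≢s
  ... | no  _   = refl
  toggle-≢ {s = s} {c} (d ∷ w) c≢s with c ≟ s
  ... | yes c≡s = contradiction c≡s c≢s
  ... | no  _   = refl

  toggle-≡ : ∀ {n s d} (w : Word n) → toggle s (s ∷ d ∷ w) ≡ s ∷ d ∷ toggle s w
  toggle-≡ {s = s} w with s ≟ s
  ... | yes _   = refl
  ... | no  s≢s = contradiction refl s≢s

  toggle-[_] : ∀ {n} s → toggle {suc n} s (s ∷ []) ≡ []
  toggle-[ s ] with s ≟ s
  ... | yes _   = refl
  ... | no  s≢s = contradiction refl s≢s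

  toggle-involutive : ∀ {n} s (w : Word n) → toggle s (toggle s w) ≡ w
  toggle-involutive {zero}  s [] = refl
  toggle-involutive {suc n} s [] = toggle-[ s ]
  toggle-involutive s (c ∷ []) with c ≟ s
  ... | yes refl = refl
  ... | no  c≢s  = trans (toggle-≢ (toggle s []) c≢s) (cong (c ∷_) (toggle-involutive s []))
  toggle-involutive s (c ∷ d ∷ w) with c ≟ s | toggle-involutive s w | toggle-involutive s (d ∷ w)
  ... | yes refl | ih | _  = trans (toggle-≡ (toggle s w)) (cong (λ w → c ∷ d ∷ w) ih)
  ... | no  c≢s  | _  | ih = trans (toggle-≢ (toggle s (d ∷ w)) c≢s) (cong (c ∷_) ih)

  -- The indices are the length and the last letter.
  data Reduced : ∀ {n} → ℕ → S → Word n → Set where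
    [-] : ∀ {n l} → Reduced {suc n} 1 l (l ∷ [])
    _∷_ : ∀ {n m l c d} {w : Word n} → c ≢ d → Reduced m l (d ∷ w) → Reduced (suc m) l (c ∷ d ∷ w)

  -- The edge from a node to its parent has the colour `l` of its last letter. If `l ≢ s`, the
  -- greedy matching of colour `s` must pair the node with its child, and `m < suc n` leaves room
  -- for that child. The first letter `c` is kept visible in the result so that the inequality with
  -- the letter before it survives the induction.
  toggle-snoc : ∀ {n m l s c} {w : Word n} → Reduced m l (c ∷ w) → l ≢ s → m < suc n →
    ∃ λ w′ → toggle s (c ∷ w) ≡ c ∷ w′ × Reduced (suc m) s (c ∷ w′)
  toggle-snoc {suc n} {s = s} [-] l≢s m<n = s ∷ [] , toggle-≢ [] l≢s , l≢s ∷ [-]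
  toggle-snoc {zero} [-] l≢s (s≤s ())
  toggle-snoc {s = s} {c} (_∷_ {d = d} c≢d r) l≢s (s≤s m<n) with c ≟ s
  toggle-snoc {s = s} {c} (_∷_ {d = d} c≢d r) l≢s (s≤s m<n) | no c≢s
    with w′ , eq , r′ ← toggle-snoc r l≢s m<n =
    d ∷ w′ , cong (c ∷_) eq , c≢d ∷ r′
  toggle-snoc {suc (suc n)} (_∷_ {d = d} c≢d [-]) l≢s (s≤s m<n) | yes refl =
    d ∷ _ ∷ [] , refl , c≢d ∷ (≢-sym c≢d ∷ [-])
  toggle-snoc {suc zero} (_∷_ {d = d} c≢d [-]) l≢s (s≤s (s≤s ())) | yes refl
  -- With first letter `s`, `toggle` skips two letters, so the induction resumes after `d`.
  toggle-snoc (_∷_ {d = d} c≢d (d≢e ∷ r)) l≢s (s≤s (s≤s m<n)) | yes refl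
    with w′ , eq , r′ ← toggle-snoc r l≢s m<n =
    d ∷ _ ∷ w′ , cong (λ w → _ ∷ d ∷ w) eq , c≢d ∷ (d≢e ∷ r′)

  reduced-toggle : ∀ {n m l s} {w : Word n} → Reduced m l w → l ≢ s → m < n → Reduced (suc m) s (toggle s w)
  reduced-toggle {w = _ ∷ _} r l≢s m<n with w′ , eq , r′ ← toggle-snoc r l≢s m<n =
    subst (Reduced _ _) (sym eq) r′
  reduced-toggle {w = []} () l≢s m<n

  reduced⇒≢[] : ∀ {n m l} {w : Word n} → Reduced m l w → w ≢ []
  reduced⇒≢[] [-]     ()
  reduced⇒≢[] (_ ∷ _) ()

-- Covers of t copies of F

≅-trans : ∀ {G H K} → G ≅ H → H ≅ K → G ≅ K
≅-trans G≅H H≅K = record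
  { bijection     = _≅_.bijection H≅K ↔-∘ _≅_.bijection G≅H
  ; adj-preserved = λ u v → trans (_≅_.adj-preserved G≅H u v) (_≅_.adj-preserved H≅K _ _)
  }

copies-cong : ∀ t {L M} → L ≅ M → copies t L ≅ copies t M
copies-cong t L≅M = record
  { bijection     = ↔-id (Fin t) ×-↔ _≅_.bijection L≅M
  ; adj-preserved = λ (i , u) (j , v) → cong (⌊ i ≟ᶠ j ⌋ ∧_) (_≅_.adj-preserved L≅M u v)
  }

induced-cycle : ∀ {G p ℓ} → Cycle (induced G p) ℓ → Cycle G ℓ
induced-cycle C = record
  { length≥3  = length≥3
  ; vertex    = proj₁ ∘ vertex
  ; injective = injective ∘ Σ-T-≡
  ; step      = step
  ; closing   = closing
  }
  where open Cycle C

-- Each i : Fin t and y : Y index a copy of F, on the vertices (a , act (i , a) y).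
module Lift
  (F : Graph) (finF : Finite F) (t : ℕ) {Y : Set} (finY : FiniteSet Y)
  (act : Fin t × Vertex F → Y → Y)
  (act-involutive : ∀ s y → act s (act s y) ≡ y)
  where

  private module F = Graph F

  X : Set
  X = F.Vertex × Y

  Block : Fin t → X → X → Set
  Block i (a , y) (b , z) = act (i , a) y ≡ act (i , b) z

  act-injective : ∀ s {y z} → act s y ≡ act s z → y ≡ z
  act-injective s {y} {z} eq = begin
    y                ≡⟨ act-involutive s y ⟨
    act s (act s y)  ≡⟨ cong (act s) eq ⟩
    act s (act s z)  ≡⟨ act-involutive s z ⟩
    z                ∎
    where open ≡-Reasoning

  block-injective : ∀ {i x x′} → Block i x x′ → proj₁ x ≡ proj₁ x′ → x ≡ x′
  block-injective {x = a , _} b refl = cong (a ,_) (act-injective _ b)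

  InBlock : X → X → Set
  InBlock x x′ = ∃ λ i → Block i x x′

  inBlock? : ∀ x x′ → Dec (InBlock x x′)
  inBlock? (a , y) (b , z) = any? λ i → finite-≟ finY (act (i , a) y) (act (i , b) z)

  lift-adj : X → X → Bool
  lift-adj x x′ = F.adj (proj₁ x) (proj₁ x′) ∧ ⌊ inBlock? x x′ ⌋

  ~-intro : ∀ {x x′} → proj₁ x F.~ proj₁ x′ → InBlock x x′ → T (lift-adj x x′)
  ~-intro {x} {x′} e b = Equivalence.from T-∧ (e , fromWitness {a? = inBlock? x x′} b)

  ~-elim : ∀ x x′ → T (lift-adj x x′) → proj₁ x F.~ proj₁ x′ × InBlock x x′
  ~-elim x x′ e with e₁ , e₂ ← Equivalence.to (T-∧ {F.adj (proj₁ x) (proj₁ x′)}) e =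
    e₁ , toWitness {a? = inBlock? x x′} e₂

  lift : Graph
  lift = record
    { Vertex   = X
    ; adj      = lift-adj
    ; ~-sym    = λ {x} {x′} e → let (e′ , i , b) = ~-elim x x′ e in ~-intro (F.~-sym e′) (i , sym b)
    ; ~-irrefl = λ x e → F.~-irrefl (proj₁ x) (proj₁ (~-elim x x e))
    }

  open Graph lift using (_~_)

  lift-finite : Finite lift
  lift-finite = finite-× finF finY

  ~⇒≢ : ∀ {x x′} → x ~ x′ → x ≢ x′
  ~⇒≢ {x} e refl = Graph.~-irrefl lift x e

  -- In Chain o n i q x, a walk from o to x through n blocks, q is the point at which
  -- the walk enters its last block, labelled i.
  data Chain (o : X) : ℕ → Fin t → X → X → Set where
    start : ∀ {i x} → Block i o x → o ≢ x → Chain o 1 i o x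
    snoc  : ∀ {n i j p q x} → Chain o n j p q → j ≢ i → Block i q x → q ≢ x → Chain o (suc n) i q x

  merge : ∀ {o n i q x x′} → Chain o n i q x → Block i x x′ → q ≢ x′ → Chain o n i q x′
  merge (start b _)     b′ q≢x = start (trans b b′) q≢x
  merge (snoc c j≢i b _) b′ q≢x = snoc c j≢i (trans b b′) q≢x

  -- The first and last labels of a closed chain may agree, so a cycle may be cut open at any
  -- vertex, even in the middle of a block.
  NoClosedChain : ℕ → X → Set
  NoClosedChain g o = ∀ {n i q} → n < g → ¬ Chain o n i q o

  -- Links in the lift

  module _ {g : ℕ} (3<g : 3 < g) where

    -- Going to `x′` in one block and back in the other would close a chain of two blocks.
    label-unique : ∀ {x x′ i j} → NoClosedChain g x → x ≢ x′ → Block i x x′ → Block j x x′ → i ≡ j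
    label-unique {i = i} {j} free x≢x′ b b′ with i ≟ᶠ j
    ... | yes i≡j = i≡j
    ... | no  i≢j = contradiction (snoc (start b x≢x′) i≢j (sym b′) (≢-sym x≢x′)) (free (<-trans (n<1+n 2) 3<g))

    -- If `m` differs from both `i` and `j`, the triangle is a closed chain of three blocks, whence
    -- `3 < g`. Otherwise two of its edges merge into one block and `label-unique` applies.
    triangle : ∀ {x u v i j m} → NoClosedChain g x → x ≢ u → u ≢ v → x ≢ v →
      Block i x u → Block m u v → Block j x v → i ≡ j
    triangle {i = i} {j} {m} free x≢u u≢v x≢v b c d with i ≟ᶠ m | m ≟ᶠ j
    ... | yes refl | _        = label-unique free x≢v (trans b c) d
    ... | no _     | yes refl = label-unique free x≢u b (trans d (sym c))
    ... | no i≢m   | no m≢j   =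
      contradiction (snoc (snoc (start b x≢u) i≢m c u≢v) m≢j (sym d) (≢-sym x≢v)) (free 3<g)

    module _
      (p : X → Bool)
      (closed : ∀ {x x′} → T (p x) → x ~ x′ → T (p x′))
      (free : ∀ x → T (p x) → NoClosedChain g x)
      where

      -- For each label `i` and each neighbour `b` of `a` in `F`, exactly one neighbour of `x` lies
      -- over `b` in the block of `x` labelled `i`. Distinct labels give disjoint families by
      -- `label-unique`, with no edges between them by `triangle`. Closedness of `p` keeps all these
      -- neighbours in the induced graph.
      link-copies : ∀ v → link (induced lift p) v ≅ copies t (link F (proj₁ (proj₁ v)))
      link-copies (x@(a , y) , px) = record
        { bijection     = mk↔ₛ′ to from to∘from from∘to
        ; adj-preserved = adj-preserved
        }
        where
        Link CLink : Set
        Link  = Vertex (link (induced lift p) (x , px))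
        CLink = Fin t × Vertex (link F a)

        nbr : CLink → X
        nbr (i , b , _) = b , act (i , b) (act (i , a) y)

        nbr-block : ∀ c → Block (proj₁ c) x (nbr c)
        nbr-block (i , b , _) = sym (act-involutive (i , b) (act (i , a) y))

        nbr-~ : ∀ c → x ~ nbr c
        nbr-~ c@(i , b , e) = ~-intro e (i , nbr-block c)

        to : Link → CLink
        to ((x′ , _) , e) = let (e′ , i , _) = ~-elim x x′ e in i , proj₁ x′ , e′

        to-block : ∀ l → Block (proj₁ (to l)) x (proj₁ (proj₁ l))
        to-block ((x′ , _) , e) = proj₂ (proj₂ (~-elim x x′ e))

        from : CLink → Link
        from c = (nbr c , closed px (nbr-~ c)) , nbr-~ c

        to∘from : ∀ c → to (from c) ≡ c
        -- The label returned by `to` is found by a search over `Fin t`, so its agreement with the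
        -- given one needs an argument.
        to∘from c = cong₂ _,_
          (label-unique (free x px) (~⇒≢ (nbr-~ c)) (to-block (from c)) (nbr-block c))
          (Σ-T-≡ refl)

        from∘to : ∀ l → from (to l) ≡ l
        from∘to l@((x′ , _) , e) = Σ-T-≡ (Σ-T-≡
          (block-injective (trans (sym (nbr-block (to l))) (to-block l)) refl))

        adj-preserved : ∀ l m → lift-adj (proj₁ (proj₁ l)) (proj₁ (proj₁ m)) ≡
          Graph.adj (copies t (link F a)) (to l) (to m)
        adj-preserved l@((u , _) , x~u) m@((v , _) , x~v) = T-ext into outof
          where
          into : u ~ v → T (Graph.adj (copies t (link F a)) (to l) (to m))
          into u~v = let (e , _ , b) = ~-elim u v u~v in Equivalence.from T-∧
            (fromWitness (triangle (free x px) (~⇒≢ x~u) (~⇒≢ u~v) (~⇒≢ x~v) (to-block l) b (to-block m)) , e)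
          outof : T (Graph.adj (copies t (link F a)) (to l) (to m)) → u ~ v
          outof e = let (i≡j , e′) = Equivalence.to (T-∧ {⌊ proj₁ (to l) ≟ᶠ proj₁ (to m) ⌋}) e in
            ~-intro e′ (_ , trans (sym (to-block l))
              (subst (λ i → Block i x v) (sym (toWitness i≡j)) (to-block m)))

  -- Short cycles in the lift

  module ShortCycle {ℓ : ℕ} (C : Cycle lift ℓ) where
    open Cycle C

    instance
      ℓ≢0 : NonZero ℓ
      ℓ≢0 = >-nonZero (<-≤-trans z<s length≥3)

    -- Indices are read modulo `ℓ`, so that the closing edge becomes the step from `ℓ - 1` to `ℓ`.
    u : ℕ → X
    u n = vertex (n mod ℓ)

    toℕ-mod : ∀ n → toℕ (n mod ℓ) ≡ n % ℓ
    toℕ-mod n = toℕ-fromℕ< (m%n<n n ℓ)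

    toℕ-mod-< : ∀ {n} → n < ℓ → toℕ (n mod ℓ) ≡ n
    toℕ-mod-< {n} n<ℓ = trans (toℕ-mod n) (m<n⇒m%n≡m n<ℓ)

    toℕ-mod-ℓ : toℕ (ℓ mod ℓ) ≡ 0
    toℕ-mod-ℓ = trans (toℕ-mod ℓ) (n%n≡0 ℓ)

    u-closes : u ℓ ≡ u 0
    u-closes = cong vertex (toℕ-injective (trans toℕ-mod-ℓ (sym (toℕ-mod-< (<-≤-trans z<s length≥3)))))

    u-toℕ : ∀ i → u (toℕ i) ≡ vertex i
    u-toℕ i = cong vertex (toℕ-injective (toℕ-mod-< (toℕ<n i)))

    u-edge : ∀ {n} → n < ℓ → u n ~ u (suc n)
    u-edge {n} n<ℓ with m≤n⇒m<n∨m≡n n<ℓ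
    ... | inj₁ 1+n<ℓ = step _ _ (trans (cong suc (toℕ-mod-< n<ℓ)) (sym (toℕ-mod-< 1+n<ℓ)))
    ... | inj₂ 1+n≡ℓ = closing _ _ (trans (cong suc (toℕ-mod-< n<ℓ)) 1+n≡ℓ)
      (trans (cong (λ k → toℕ (k mod ℓ)) 1+n≡ℓ) toℕ-mod-ℓ)

    u-block : ∀ {n} → n < ℓ → InBlock (u n) (u (suc n))
    u-block {n} n<ℓ = proj₂ (~-elim (u n) (u (suc n)) (u-edge n<ℓ))

    u-distinct : ∀ {m n} → m < n → n < ℓ → u m ≢ u n
    u-distinct m<n n<ℓ eq = <⇒≢ m<n
      (trans (sym (toℕ-mod-< (<-trans m<n n<ℓ))) (trans (cong toℕ (injective eq)) (toℕ-mod-< n<ℓ)))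

    u-distinct⁺ : ∀ {m n} → 0 < m → m < n → n ≤ ℓ → u m ≢ u n
    u-distinct⁺ 0<m m<n n≤ℓ with m≤n⇒m<n∨m≡n n≤ℓ
    ... | inj₁ n<ℓ  = u-distinct m<n n<ℓ
    ... | inj₂ refl = λ eq → u-distinct 0<m m<n (sym (trans eq u-closes))

    OneBlock : ℕ → Set
    OneBlock m = ∃ λ i → ∀ {q} → q ≤ m → Block i (u 0) (u q)

    -- Entering the last block after u 0 keeps the entry point different from u ℓ = u 0.
    LongChain : ℕ → Set
    LongChain m = ∃₂ λ n i → ∃ λ q → n ≤ m × 0 < q × q < m × Chain (u 0) n i (u q) (u m)

    -- Induction along the walk: an edge with the current label prolongs the last block, and an edge
    -- with another label opens a new block at the vertex just reached.
    chain : ∀ m → suc m ≤ ℓ → OneBlock (suc m) ⊎ LongChain (suc m)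
    chain zero 0<ℓ with i , b ← u-block 0<ℓ = inj₁ (i , first)
      where
      first : ∀ {q} → q ≤ 1 → Block i (u 0) (u q)
      first z≤n       = refl
      first (s≤s z≤n) = b
    chain (suc m) m<ℓ with u-block m<ℓ | chain m (<⇒≤ m<ℓ)
    ... | i , b | inj₁ (j , all) with j ≟ᶠ i
    ...   | yes refl = inj₁ (j , extend)
      where
      extend : ∀ {q} → q ≤ suc (suc m) → Block j (u 0) (u q)
      extend q≤ with m≤n⇒m<n∨m≡n q≤
      ... | inj₁ q<   = all (m<1+n⇒m≤n q<)
      ... | inj₂ refl = trans (all ≤-refl) b
    ...   | no j≢i = inj₂ (2 , i , suc m , s≤s (s≤s z≤n) , z<s , ≤-refl ,
      snoc (start (all ≤-refl) (u-distinct z<s m<ℓ)) j≢i b (u-distinct⁺ z<s ≤-refl m<ℓ))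
    chain (suc m) m<ℓ | i , b | inj₂ (n , j , q , n≤m , 0<q , q<m , c) with j ≟ᶠ i
    ...   | yes refl = inj₂ (n , j , q , m≤n⇒m≤1+n n≤m , 0<q , m≤n⇒m≤1+n q<m ,
      merge c b (u-distinct⁺ 0<q (m≤n⇒m≤1+n q<m) m<ℓ))
    ...   | no j≢i = inj₂ (suc n , i , suc m , s≤s n≤m , z<s , ≤-refl ,
      snoc c j≢i b (u-distinct⁺ z<s ≤-refl m<ℓ))

    -- The alternative is a chain once around the cycle; it is closed and has at most `ℓ` blocks.
    one-block : ∀ {g} → ℓ < g → NoClosedChain g (u 0) → OneBlock ℓ
    one-block ℓ<g free = go ℓ refl
      where
      go : ∀ m → m ≡ ℓ → OneBlock ℓ
      go zero    refl = contradiction length≥3 λ ()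
      go (suc m) refl with chain m ≤-refl
      ... | inj₁ b = b
      ... | inj₂ (_ , _ , _ , n≤ℓ , _ , _ , c) =
        contradiction (subst (Chain _ _ _ _) u-closes c) (free (≤-<-trans n≤ℓ ℓ<g))

    -- Inside one block the projection to `F` is injective, by `block-injective`.
    project : OneBlock ℓ → Cycle F ℓ
    project (i , block) = record
      { length≥3  = length≥3
      ; vertex    = proj₁ ∘ vertex
      ; injective = λ {j} {k} eq → injective (block-injective (trans (sym (block′ j)) (block′ k)) eq)
      ; step      = λ j k eq → proj₁ (~-elim _ _ (step j k eq))
      ; closing   = λ j k eq eq′ → proj₁ (~-elim _ _ (closing j k eq eq′))
      }
      where
      block′ : ∀ j → Block i (u 0) (vertex j)
      block′ j = subst (Block i (u 0)) (u-toℕ j) (block (<⇒≤ (toℕ<n j)))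

-- The action on enumerations of the ball

module Construction (F : Graph) (finF : Finite F) (t g : ℕ) (a₀ : Vertex F) where

  S : Set
  S = Fin t × Vertex F

  finite-S : FiniteSet S
  finite-S = finite-× (t , ↔-id (Fin t)) finF

  open Words (finite-≟ finite-S)

  -- A chain of n blocks spells a word of length 2n.
  Z : Set
  Z = Word (g * 2)

  finite-Z : FiniteSet Z
  finite-Z = finite-Word finite-S (g * 2)

  N : ℕ
  N = proj₁ finite-Z

  Y : Set
  Y = Vec Z N

  act : S → Y → Y
  act s = Vec.map (toggle s)

  act-involutive : ∀ s y → act s (act s y) ≡ y
  act-involutive s y = begin
    act s (act s y)                   ≡⟨ map-∘ (toggle s) (toggle s) y ⟨
    Vec.map (toggle s ∘ toggle s) y   ≡⟨ map-cong (toggle-involutive s) y ⟩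
    Vec.map id y                      ≡⟨ map-id y ⟩
    y                                 ∎
    where open ≡-Reasoning

  open Lift F finF t (finite-Vec finite-Z N) act act-involutive public

  -- The orbit of such a state is free in short words: some coordinate is the root [].
  Covers : Y → Set
  Covers y = ∀ z → ∃ λ k → lookup y k ≡ z

  -- Being an involution, `toggle s` is surjective.
  covers-act : ∀ s y → Covers y → Covers (act s y)
  covers-act s y cov z = let (k , eq) = cov (toggle s z) in k , (begin
    lookup (act s y) k       ≡⟨ lookup-map k (toggle s) y ⟩
    toggle s (lookup y k)    ≡⟨ cong (toggle s) eq ⟩
    toggle s (toggle s z)    ≡⟨ toggle-involutive s z ⟩
    z                        ∎)
    where open ≡-Reasoning

  block⇒act : ∀ {i x x′} → Block i x x′ → proj₂ x′ ≡ act (i , proj₁ x′) (act (i , proj₁ x) (proj₂ x))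
  block⇒act b = trans (sym (act-involutive _ _)) (cong (act _) (sym b))

  covers-star : ∀ {x x′} → Star (Graph._~_ lift) x x′ → Covers (proj₂ x) → Covers (proj₂ x′)
  covers-star ε cov = cov
  covers-star {x} (_◅_ {j = x₁} e s) cov = let (_ , i , b) = ~-elim x x₁ e in covers-star s
    (subst Covers (sym (block⇒act {i} {x} {x₁} b))
      (covers-act (i , proj₁ x₁) (act (i , proj₁ x) (proj₂ x)) (covers-act (i , proj₁ x) (proj₂ x) cov)))

  y₀ : Y
  y₀ = Vec.tabulate (Inverse.from (proj₂ finite-Z))

  covers-y₀ : Covers y₀
  covers-y₀ z = to z , trans (lookup∘tabulate from (to z)) (strictlyInverseʳ z)
    where open Inverse (proj₂ finite-Z)

  -- Crossing a block thus applies two letters with the same label to every coordinate.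
  lookup-block : ∀ {i x x′} k → Block i x x′ →
    lookup (proj₂ x′) k ≡ toggle (i , proj₁ x′) (toggle (i , proj₁ x) (lookup (proj₂ x) k))
  lookup-block {i} {x} {x′} k b = begin
    lookup (proj₂ x′) k
      ≡⟨ cong (λ y → lookup y k) (block⇒act {i} {x} {x′} b) ⟩
    lookup (act (i , proj₁ x′) (act (i , proj₁ x) (proj₂ x))) k
      ≡⟨ lookup-map k _ (act (i , proj₁ x) (proj₂ x)) ⟩
    toggle (i , proj₁ x′) (lookup (act (i , proj₁ x) (proj₂ x)) k)
      ≡⟨ cong (toggle _) (lookup-map k _ (proj₂ x)) ⟩
    toggle (i , proj₁ x′) (toggle (i , proj₁ x) (lookup (proj₂ x) k)) ∎
    where open ≡-Reasoning

  block-≢ : ∀ {i x x′} → Block i x x′ → x ≢ x′ → (i , proj₁ x) ≢ (i , proj₁ x′)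
  block-≢ {i} {x} {x′} b x≢x′ eq = x≢x′ (block-injective {i} {x} {x′} b (cong proj₂ eq))

  -- The spelled word is reduced: the two letters of one block differ in their vertices by
  -- `block-≢`, and letters of consecutive blocks differ in their labels. Starting from the root,
  -- each toggle therefore appends its letter, and `n ≤ g` keeps all `n * 2` letters within the
  -- ball.
  chain⇒reduced : ∀ {o n i q x} k → lookup (proj₂ o) k ≡ [] → n ≤ g → Chain o n i q x →
    Reduced (n * 2) (i , proj₁ x) (lookup (proj₂ x) k)
  chain⇒reduced {o} {i = i} {x = x} k o[k]≡[] n≤g (start b o≢x) =
    subst (Reduced 2 _) (sym (trans (lookup-block {i} {o} {x} k b) (cong (toggle _ ∘ toggle _) o[k]≡[])))
      (first n≤g)
    where
    -- The variable `h` stands for `g`; matching exposes a successor, so that the first toggle of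
    -- the root computes to a one-letter word.
    first : ∀ {h} → 1 ≤ h →
      Reduced 2 (i , proj₁ x) (toggle (i , proj₁ x) (toggle (i , proj₁ o) ([] {h * 2})))
    first {suc h} _ = reduced-toggle [-] (block-≢ {i} {o} {x} b o≢x) (s≤s (s≤s z≤n))
  chain⇒reduced {n = suc n} {i} {q} {x} k o[k]≡[] n<g (snoc c j≢i b q≢x) =
    subst (Reduced _ _) (sym (lookup-block {i} {q} {x} k b))
      (reduced-toggle
        (reduced-toggle (chain⇒reduced k o[k]≡[] (<⇒≤ n<g) c) (j≢i ∘ cong proj₁) (<⇒≤ 2+2n≤2g))
        (block-≢ {i} {q} {x} b q≢x) 2+2n≤2g)
    where
    2+2n≤2g : suc n * 2 ≤ g * 2
    2+2n≤2g = *-monoˡ-≤ 2 n<g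

  -- A closed chain would return the coordinate holding the root to the root, although it has become
  -- a nonempty reduced word.
  covers⇒noClosedChain : ∀ {x} → Covers (proj₂ x) → NoClosedChain g x
  covers⇒noClosedChain cov n<g c = let (k , eq) = cov [] in
    reduced⇒≢[] (chain⇒reduced k eq (<⇒≤ n<g) c) eq

  open Component lift lift-finite (a₀ , y₀) public

  component-free : ∀ x → T (inComponent x) → NoClosedChain g x
  component-free x r = covers⇒noClosedChain (covers-star (inComponent⇒star x r) covers-y₀)

theorem6 : (F L : Graph) (k c : ℕ) →
    Finite L →
    Connected F → HasConstantLink F L → HasOrder F k → HasCircumference F c →
    3 ≤ c → c ≤ k →
    (t g : ℕ) → 2 ≤ t → c < g →
    Σ[ G ∈ Graph ]
    (Finite G × Connected G × HasConstantLink G (copies t L) ×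
    (∀ ℓ → c < ℓ → ℓ < g → ¬ Cycle G ℓ))
theorem6 F L k c _ (a₀ , _) linkF order (_ , longest) 3≤c _ t g _ c<g =
  component , component-finite , component-connected , constantLink , noCycle
  where
  open Construction F (k , order) t g a₀

  constantLink : HasConstantLink component (copies t L)
  constantLink v = ≅-trans {H = copies t (link F (proj₁ (proj₁ v)))}
    -- The bound `3 < g`, needed for triangles, comes from `3 ≤ c < g`.
    (link-copies (≤-<-trans 3≤c c<g) inComponent closed component-free v)
    (copies-cong t (linkF (proj₁ (proj₁ v))))

  noCycle : ∀ ℓ → c < ℓ → ℓ < g → ¬ Cycle component ℓ
  -- As `ℓ < g`, the cycle lies in one block and projects to a cycle of `F` longer than its
  -- circumference.
  noCycle ℓ c<ℓ ℓ<g C = <⇒≱ c<ℓ (longest ℓ (project (one-block ℓ<g (component-free (u 0) u∈))))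
    where
    open ShortCycle (induced-cycle C)
    u∈ : T (inComponent (u 0))
    u∈ = proj₂ (Cycle.vertex C _)
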